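{- For any (finite, simple) graph $H$ without isolated vertices the following hold: (i) $\frac{AR_{loc}(H)^{1/3}}{2} \leq AR_{FF}(H) \leq AR_o(H) \leq AR_s(H) \leq \binom{AR_{loc}(H)}{2}$; (ii) $AR_s(H) \geq \frac{1}{2} AR_{loc}(H)\,\delta(H)$, where $\delta(H)$ denotes the minimum degree of $H$.
   Context: All graphs are finite and simple. Edges are colored with natural numbers $1,2,\ldots$. An edge-coloring is proper if adjacent edges receive distinct colors. A graph with an edge-coloring is rainbow if all its edges have distinct colors; a copy of $H$ is a (not necessarily induced) subgraph isomorphic to $H$. The size anti-Ramsey number $AR_s(H)$ is the smallest number of edges in a graph $G$ such that every proper edge-coloring of $G$ contains a rainbow copy of $H$. The local anti-Ramsey number $AR_{loc}(H)$ is the smallest $n$ such that every proper edge-coloring of the complete graph $K_n$ contains a rainbow copy of $H$. The online anti-Ramsey number $AR_o(H)$ is defined by a game between Builder and Painter: Builder creates vertices and edges, one edge at a time (the graph stays simple); immediately after each edge is built, Painter irrevocably colors it so that the coloring stays proper. Both players have complete information. $AR_o(H)$ is the smallest $t$ such that Builder has a strategy which, against every Painter, guarantees a rainbow copy of $H$ after at most $t$ edges have been built and colored. The First-Fit anti-Ramsey number $AR_{FF}(H)$ is defined in the same way except that Painter must use the First-Fit strategy: each new edge gets the smallest color in $\{1,2,\ldots\}$ not used on an adjacent edge already presented. -}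

module Defs where

open import Data.Fin.Base using (Fin)
import Data.Fin.Base as Fin
import Data.Fin.Properties as Fin
open import Data.List.Base using (List; []; _∷_; length; map; filter; allFin; cartesianProduct)
open import Data.List.Extrema.Nat using (min)
open import Data.List.Membership.Propositional using (_∈_)
open import Data.Nat.Base using (ℕ; suc; _≤_)
open import Data.Product.Base using (_×_; _,_; ∃)
open import Data.Sum.Base using (_⊎_)
open import Function.Definitions using (Injective)
open import Level as Level using (Level; 0ℓ)
open import Relation.Binary.Core using (Rel)
open import Relation.Binary.Definitions using (Symmetric; Irreflexive; Decidable)
open import Relation.Binary.PropositionalEquality.Core using (_≡_; _≢_; sym)
open import Relation.Nullary.Decidable using (¬?; _×-dec_)
open import Relation.Nullary.Negation.Core using (¬_)
open import Relation.Unary using (Pred)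

private
  variable
    ℓ : Level

IsLeast : Pred ℕ ℓ → Pred ℕ ℓ
IsLeast P n = P n × (∀ m → P m → n ≤ m)

record Graph : Set₁ where
  infix 4 _~_ _~?_
  field
    order    : ℕ
    _~_      : Rel (Fin order) 0ℓ
    ~-sym    : Symmetric _~_
    ~-irrefl : Irreflexive _≡_ _~_
    _~?_     : Decidable _~_

  Vertex : Set
  Vertex = Fin order

  -- Each edge is listed once, with its smaller endpoint first.
  edges : List (Vertex × Vertex)
  edges = filter (λ (u , v) → (u Fin.<? v) ×-dec (u ~? v))
                 (cartesianProduct (allFin order) (allFin order))

  size : ℕ
  size = length edges

  degree : Vertex → ℕ
  degree v = length (filter (v ~?_) (allFin order))

-- The value at [] makes the minimum degree of the graph with no vertices 0.
minimum : List ℕ → ℕ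
minimum []       = 0
minimum (x ∷ xs) = min x xs

δ : Graph → ℕ
δ G = minimum (map degree (allFin order))
  where open Graph G

NoIsolatedVertices : Graph → Set
NoIsolatedVertices G = ∀ u → ∃ λ v → u ~ v
  where open Graph G

K : ℕ → Graph
K n = record
  { order    = n
  ; _~_      = _≢_
  ; ~-sym    = λ u≢v v≡u → u≢v (sym v≡u)
  ; ~-irrefl = λ u≡v u≢v → u≢v u≡v
  ; _~?_     = λ u v → ¬? (u Fin.≟ v)
  }

-- Only the values of `color` on adjacent pairs are meaningful.
record EdgeColoring (G : Graph) : Set where
  open Graph G
  field
    color     : Vertex → Vertex → ℕ
    color-sym : ∀ {u v} → u ~ v → color u v ≡ color v u
    color≥1   : ∀ {u v} → u ~ v → 1 ≤ color u v

Proper : ∀ {G} → EdgeColoring G → Set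
Proper {G} c = ∀ {u v w} → u ~ v → u ~ w → v ≢ w → color u v ≢ color u w
  where open Graph G; open EdgeColoring c

-- An edge-colored graph on V, given as the relation "uv is an edge of color k".
ColoredEdges : Set → Set₁
ColoredEdges V = V → V → ℕ → Set

colored : ∀ {G} → EdgeColoring G → ColoredEdges (Graph.Vertex G)
colored {G} c u v k = u ~ v × color u v ≡ k
  where open Graph G; open EdgeColoring c

SameEdge : {V : Set} → V × V → V × V → Set
SameEdge (u , v) (x , y) = (u ≡ x × v ≡ y) ⊎ (u ≡ y × v ≡ x)

record RainbowCopy (H : Graph) {V : Set} (E : ColoredEdges V) : Set where
  open Graph H
  field
    embed     : Vertex → V
    injective : Injective _≡_ _≡_ embed
    edge      : ∀ {u v} → u ~ v → ∃ λ k → E (embed u) (embed v) k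
    rainbow   : ∀ {u v x y k} → u ~ v → x ~ y →
                E (embed u) (embed v) k → E (embed x) (embed y) k →
                SameEdge (u , v) (x , y)

ForcesRainbow : Graph → Graph → Set
ForcesRainbow G H = (c : EdgeColoring G) → Proper c → RainbowCopy H (colored c)

-- The game is played on the vertex supply ℕ. A position lists the edges built
-- so far, (u , v , k) being the edge uv of color k.
Position : Set
Position = List (ℕ × ℕ × ℕ)

built : Position → ColoredEdges ℕ
built p u v k = (u , v , k) ∈ p ⊎ (v , u , k) ∈ p

Buildable : Position → ℕ → ℕ → Set
Buildable p u v = u ≢ v × ¬ (∃ λ k → built p u v k)

-- What Painter may answer, in a given position, to the new edge uv.
PainterRule : Set₁
PainterRule = Position → ℕ → ℕ → Pred ℕ 0ℓ

ProperRule : PainterRule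
ProperRule p u v k = 1 ≤ k × (∀ w → ¬ built p u w k × ¬ built p v w k)

FirstFitRule : PainterRule
FirstFitRule p u v = IsLeast (ProperRule p u v)

-- Elements of `BuilderWins R H t p` are Builder's strategy trees guaranteeing,
-- from position p, a rainbow copy of H within t further edges against every
-- Painter who follows the rule R.
data BuilderWins (R : PainterRule) (H : Graph) : ℕ → Position → Set where
  done  : ∀ {t p} → RainbowCopy H (built p) → BuilderWins R H t p
  build : ∀ {t p} u v → Buildable p u v →
          (∀ k → R p u v k → BuilderWins R H t ((u , v , k) ∷ p)) →
          BuilderWins R H (suc t) p

-- The anti-Ramsey numbers of H are the least elements of the following sets.

SizeBound : Graph → Pred ℕ (Level.suc 0ℓ)
SizeBound H m = ∃ λ G → Graph.size G ≡ m × ForcesRainbow G H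

LocalBound : Graph → Pred ℕ 0ℓ
LocalBound H n = ForcesRainbow (K n) H

OnlineBound : Graph → Pred ℕ 0ℓ
OnlineBound H t = BuilderWins ProperRule H t []

FirstFitBound : Graph → Pred ℕ 0ℓ
FirstFitBound H t = BuilderWins FirstFitRule H t []

IsAR-size : Graph → Pred ℕ (Level.suc 0ℓ)
IsAR-size H = IsLeast (SizeBound H)

IsAR-loc : Graph → Pred ℕ 0ℓ
IsAR-loc H = IsLeast (LocalBound H)

IsAR-online : Graph → Pred ℕ 0ℓ
IsAR-online H = IsLeast (OnlineBound H)

IsAR-FF : Graph → Pred ℕ 0ℓ
IsAR-FF H = IsLeast (FirstFitBound H)

{-# OPTIONS --safe #-}
module Submission where

-- Write h for the order of H. A rainbow K_h is found greedily in any properly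
-- coloured K_n with n ≥ h³: for each chosen vertex and each colour already used,
-- at most one further vertex is excluded, so (h-1)³ at most in the last step. Thus
-- AR_loc ≤ h³, while a built copy of H, having no isolated vertices, needs at least
-- h / 2 edges; this bounds AR_FF below. Builder wins online by building a graph that
-- forces H. For (ii), if G forces H then so does the complete graph on the vertices
-- of degree at least δ(H) in G, so there are at least AR_loc such vertices.

open import Defs
open import Data.Bool.Base using (true; false)
open import Data.Fin.Base using (Fin; zero; suc; toℕ; combine)
import Data.Fin.Base as Fin
import Data.Fin.Properties as Fin
open import Data.List.Base using (List; []; _∷_; _++_; length; map; filter; lookup; allFin; cartesianProduct)
open import Data.List.Extrema.Nat using (max; xs≤max; min≤v⁺)
open import Data.List.Membership.Propositional using (_∈_; find; lose)
open import Data.List.Membership.Propositional.Properties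
open import Data.List.Membership.Setoid.Properties using (index-injective)
open import Data.List.Properties using (length-map; length-++; filter-++; length-tabulate)
open import Data.List.Relation.Binary.Subset.Propositional using (_⊆_)
import Data.List.Relation.Unary.All as All
open import Data.List.Relation.Unary.Any as Any using (Any; here; there; any?)
open import Data.List.Relation.Unary.Unique.Propositional using (Unique; _∷_)
import Data.List.Relation.Unary.Unique.Propositional.Properties as Unique
open import Data.Nat.Base using (ℕ; zero; suc; _+_; _*_; _^_; _≤_; _<_; z≤n; s≤s)
open import Data.Nat.Combinatorics using (_C_; nC1≡n; nCk+nC[k+1]≡[n+1]C[k+1])
open import Data.Nat.Induction using (<-rec)
open import Data.Nat.Properties
open import Data.Nat.Tactic.RingSolver using (solve-∀)
open import Data.Product.Base using (_×_; _,_; ∃; Σ-syntax; proj₁; proj₂; swap; map₂)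
open import Data.Sum.Base using (_⊎_; inj₁; inj₂; [_,_]′)
open import Function.Base using (_∘_; id)
open import Function.Definitions using (Injective)
open import Level using (0ℓ)
open import Relation.Binary.Definitions using (tri<; tri≈; tri>)
open import Relation.Binary.PropositionalEquality
open import Relation.Nullary
open import Relation.Nullary.Decidable using (map′; ¬?; _×-dec_; dec-yes-irr)
open import Relation.Unary using (Pred; Satisfiable; Decidable)

-- Least naturals, and lengths of lists compared by injections

∃⇒IsLeast : {P : Pred ℕ 0ℓ} → Decidable P → ∀ n → P n → ∃ (IsLeast P)
∃⇒IsLeast {P} P? = <-rec (λ n → P n → ∃ (IsLeast P)) step
  where
  step : ∀ n → (∀ {m} → m < n → P m → ∃ (IsLeast P)) → P n → ∃ (IsLeast P)
  step n rec pn with anyUpTo? P? n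
  ... | yes (m , m<n , pm) = rec m<n pm
  ... | no  none           = n , pn , λ m pm → ≮⇒≥ (λ m<n → none (m , m<n , pm))

module _ {A : Set} where

  injective-∈⇒≤ : ∀ {n} {f : Fin n → A} {xs} → Injective _≡_ _≡_ f →
                  (∀ i → f i ∈ xs) → n ≤ length xs
  injective-∈⇒≤ f-inj f∈ = Fin.injective⇒≤ (f-inj ∘ index-injective (setoid A) (f∈ _) (f∈ _))

  Unique⇒lookup-injective : ∀ {xs : List A} → Unique xs →
                            Injective _≡_ _≡_ (lookup xs)
  Unique⇒lookup-injective (_  ∷ _) {zero}  {zero}  _ = refl
  Unique⇒lookup-injective (x∉ ∷ _) {zero}  {suc j} e = contradiction e (All.lookup x∉ (∈-lookup j))
  Unique⇒lookup-injective (x∉ ∷ _) {suc i} {zero}  e = contradiction (sym e) (All.lookup x∉ (∈-lookup i))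
  Unique⇒lookup-injective (_  ∷ u) {suc i} {suc j} e = cong suc (Unique⇒lookup-injective u e)

  Unique-⊆⇒length≤ : ∀ {xs ys : List A} → Unique xs → xs ⊆ ys → length xs ≤ length ys
  Unique-⊆⇒length≤ u xs⊆ys = injective-∈⇒≤ (Unique⇒lookup-injective u) (xs⊆ys ∘ ∈-lookup)

-- Edge counts

module _ (G : Graph) where
  open Graph G

  arcs : List (Vertex × Vertex)
  arcs = filter (λ (u , v) → u ~? v) (cartesianProduct (allFin order) (allFin order))

  <×~⇒∈edges : ∀ {u v} → u Fin.< v → u ~ v → (u , v) ∈ edges
  <×~⇒∈edges {u} {v} u<v u~v =
    ∈-filter⁺ _ (∈-cartesianProduct⁺ (∈-allFin u) (∈-allFin v)) (u<v , u~v)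

  ∈edges⇒<×~ : ∀ {u v} → (u , v) ∈ edges → u Fin.< v × u ~ v
  ∈edges⇒<×~ e = proj₂ (∈-filter⁻ _ {xs = cartesianProduct (allFin order) (allFin order)} e)

  ~⇒∈edges : ∀ {u v} → u ~ v → (u , v) ∈ edges ⊎ (v , u) ∈ edges
  ~⇒∈edges {u} {v} u~v with Fin.<-cmp u v
  ... | tri< u<v _ _ = inj₁ (<×~⇒∈edges u<v u~v)
  ... | tri≈ _ u≡v _ = contradiction u~v (~-irrefl u≡v)
  ... | tri> _ _ v<u = inj₂ (<×~⇒∈edges v<u (~-sym u~v))

  -- Half of the handshake identity: each arc, read in one direction or the other, is a listed edge,
  -- so the distinct arcs fit into `edges` followed by its reversal.
  arcs≤2*size : length arcs ≤ 2 * size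
  arcs≤2*size = begin
    length arcs                        ≤⟨ Unique-⊆⇒length≤ unique arcs⊆ ⟩
    length (edges ++ map swap edges)   ≡⟨ length-++ edges ⟩
    size + length (map swap edges)     ≡⟨ cong (size +_) (length-map swap edges) ⟩
    size + size                        ≡⟨ cong (size +_) (+-identityʳ size) ⟨
    2 * size                           ∎
    where
    open ≤-Reasoning
    unique : Unique arcs
    unique = Unique.filter⁺ _
      (Unique.cartesianProduct⁺ (Unique.allFin⁺ order) (Unique.allFin⁺ order))
    arcs⊆ : arcs ⊆ edges ++ map swap edges
    arcs⊆ a∈ with ~⇒∈edges (proj₂ (∈-filter⁻ _ {xs = cartesianProduct (allFin order) (allFin order)} a∈))
    ... | inj₁ e = ∈-++⁺ˡ e
    ... | inj₂ e = ∈-++⁺ʳ edges (∈-map⁺ swap e)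

  -- In the product, the pairs starting at the head `v` form a block, and the test keeps exactly
  -- `degree v` of them.
  degrees≥⇒arcs≥ : ∀ d vs → (∀ {v} → v ∈ vs → d ≤ degree v) →
    length vs * d ≤ length (filter (λ (u , v) → u ~? v) (cartesianProduct vs (allFin order)))
  degrees≥⇒arcs≥ d []       _  = z≤n
  degrees≥⇒arcs≥ d (v ∷ vs) d≤ = begin
    d + length vs * d
      ≤⟨ +-mono-≤ (d≤ (here refl)) (degrees≥⇒arcs≥ d vs (d≤ ∘ there)) ⟩
    degree v + length (filter P? rest)
      ≡⟨ cong (_+ length (filter P? rest)) (degree≡ (allFin order)) ⟨
    length (filter P? (map (v ,_) (allFin order))) + length (filter P? rest)
      ≡⟨ length-++ (filter P? (map (v ,_) (allFin order))) ⟨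
    length (filter P? (map (v ,_) (allFin order)) ++ filter P? rest)
      ≡⟨ cong length (filter-++ P? (map (v ,_) (allFin order)) rest) ⟨
    length (filter P? (map (v ,_) (allFin order) ++ rest)) ∎
    where
    open ≤-Reasoning
    P? : Decidable (λ ((u , v) : Vertex × Vertex) → u ~ v)
    P? (u , v) = u ~? v
    rest : List (Vertex × Vertex)
    rest = cartesianProduct vs (allFin order)
    degree≡ : ∀ ws → length (filter P? (map (v ,_) ws)) ≡ length (filter (v ~?_) ws)
    degree≡ []       = refl
    degree≡ (w ∷ ws) with does (v ~? w)
    ... | true  = cong suc (degree≡ ws)
    ... | false = degree≡ ws

  δ≤degree : ∀ v → δ G ≤ degree v
  δ≤degree v = minimum≤ (∈-map⁺ degree (∈-allFin v))
    where
    minimum≤ : ∀ {xs x} → x ∈ xs → minimum xs ≤ x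
    minimum≤ {y ∷ ys} (here refl) = min≤v⁺ y ys (inj₁ ≤-refl)
    minimum≤ {y ∷ ys} (there x∈)  = min≤v⁺ y ys (inj₂ (Any.map (≤-reflexive ∘ sym) x∈))

  highDegree : ℕ → List Vertex
  highDegree d = filter (λ v → d ≤? degree v) (allFin order)

  -- The arcs leaving the high-degree vertices are counted in two ways. The 2 here is the
  -- denominator in (ii).
  highDegree*≤2*size : ∀ d → length (highDegree d) * d ≤ 2 * size
  highDegree*≤2*size d = begin
    length (highDegree d) * d
      ≤⟨ degrees≥⇒arcs≥ d (highDegree d) (λ v∈ → proj₂ (∈-filter⁻ _ {xs = allFin order} v∈)) ⟩
    length highArcs           ≤⟨ Unique-⊆⇒length≤ unique highArcs⊆arcs ⟩
    length arcs               ≤⟨ arcs≤2*size ⟩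
    2 * size                  ∎
    where
    open ≤-Reasoning
    highArcs : List (Vertex × Vertex)
    highArcs = filter (λ (u , v) → u ~? v) (cartesianProduct (highDegree d) (allFin order))
    unique : Unique highArcs
    unique = Unique.filter⁺ _
      (Unique.cartesianProduct⁺ (Unique.filter⁺ _ (Unique.allFin⁺ order)) (Unique.allFin⁺ order))
    highArcs⊆arcs : highArcs ⊆ arcs
    highArcs⊆arcs {u , v} a∈ = ∈-filter⁺ _ (∈-cartesianProduct⁺ (∈-allFin u) (∈-allFin v))
      (proj₂ (∈-filter⁻ _ {xs = cartesianProduct (highDegree d) (allFin order)} a∈))

-- The recursion splits off the pairs that contain `zero`, following Pascal's rule, so that the
-- length can be read off as a binomial coefficient.
increasingPairs : ∀ n → List (Fin n × Fin n)
increasingPairs zero    = []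
increasingPairs (suc n) = map (λ v → zero , suc v) (allFin n) ++
                          map (λ (u , v) → suc u , suc v) (increasingPairs n)

∈-increasingPairs : ∀ {n} {u v : Fin n} → u Fin.< v → (u , v) ∈ increasingPairs n
∈-increasingPairs {u = zero}  {suc v} _         = ∈-++⁺ˡ (∈-map⁺ _ (∈-allFin v))
∈-increasingPairs {u = suc u} {suc v} (s≤s u<v) = ∈-++⁺ʳ _ (∈-map⁺ _ (∈-increasingPairs u<v))

length-increasingPairs : ∀ n → length (increasingPairs n) ≡ n C 2
length-increasingPairs zero    = refl
length-increasingPairs (suc n) = begin
  length (map (λ v → zero {n} , suc v) (allFin n) ++ shifted)
    ≡⟨ length-++ (map (λ v → zero {n} , suc v) (allFin n)) ⟩
  length (map (λ v → zero {n} , suc v) (allFin n)) + length shifted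
    ≡⟨ cong₂ _+_ (trans (length-map _ (allFin n)) (length-tabulate {n = n} id))
                 (trans (length-map _ (increasingPairs n)) (length-increasingPairs n)) ⟩
  n + n C 2
    ≡⟨ cong (_+ n C 2) (nC1≡n n) ⟨
  n C 1 + n C 2
    ≡⟨ nCk+nC[k+1]≡[n+1]C[k+1] n 1 ⟩
  suc n C 2 ∎
  where
  open ≡-Reasoning
  shifted : List (Fin (suc n) × Fin (suc n))
  shifted = map (λ (u , v) → suc u , suc v) (increasingPairs n)

size-K≤ : ∀ n → Graph.size (K n) ≤ n C 2
size-K≤ n = ≤-trans
  (Unique-⊆⇒length≤
    (Unique.filter⁺ _ (Unique.cartesianProduct⁺ (Unique.allFin⁺ n) (Unique.allFin⁺ n)))
    (∈-increasingPairs ∘ proj₁ ∘ ∈edges⇒<×~ (K n)))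
  (≤-reflexive (length-increasingPairs n))

-- Rainbow copies in complete graphs

-- Leaves an unblocked vertex at every greedy step: the left side counts the triples that can block
-- one when `i` vertices are chosen.
i*[i*i]<[1+i]³ : ∀ i → i * (i * i) < suc i ^ 3
i*[i*i]<[1+i]³ i = ≤-trans (s≤s (m≤m+n (i * (i * i)) (3 * i * i + 3 * i)))
                           (≤-reflexive (expand i))
  where
  expand : ∀ i → suc (i * (i * i) + (3 * i * i + 3 * i)) ≡ suc i * (suc i * (suc i * 1))
  expand = solve-∀

module _ {n} (d : Fin n → Fin n → ℕ)
         (d-sym : ∀ u v → d u v ≡ d v u)
         (d-diag : ∀ u → d u u ≡ 0)
         (d-latin : ∀ u {v w} → d u v ≡ d u w → v ≡ w) where

  -- Only `a` and `b` have to differ. Allowing `x` to equal `y` compares edges with the diagonal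
  -- value 0 as well, which builds injectivity into the notion.
  Rainbow : ∀ {i} → (Fin i → Fin n) → Set
  Rainbow f = ∀ {a b x y} → a ≢ b → d (f a) (f b) ≡ d (f x) (f y) → SameEdge (a , b) (x , y)

  -- If `f a` and `f b` coincide, the pair `(a , b)` has the same value as the diagonal pair
  -- `(a , a)`.
  Rainbow⇒injective : ∀ {i} {f : Fin i → Fin n} → Rainbow f → Injective _≡_ _≡_ f
  Rainbow⇒injective {f = f} rainbow {a} {b} fa≡fb with a Fin.≟ b
  ... | yes a≡b = a≡b
  ... | no  a≢b with rainbow {x = a} {a} a≢b (cong (d (f a)) (sym fa≡fb))
  ...   | inj₁ (_ , b≡a) = sym b≡a
  ...   | inj₂ (_ , b≡a) = sym b≡a

  -- The indices `a` and `b` may coincide, so 0 counts as a used value and the vertices already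
  -- chosen are blocked too.
  Blocked : ∀ {i} → (Fin i → Fin n) → Fin n → Set
  Blocked f w = ∃ λ j → ∃ λ a → ∃ λ b → d (f j) w ≡ d (f a) (f b)

  blocked? : ∀ {i} (f : Fin i → Fin n) → Decidable (Blocked f)
  blocked? f w = Fin.any? λ j → Fin.any? λ a → Fin.any? λ b → d (f j) w ≟ d (f a) (f b)

  -- A blocked vertex is recovered from its triple `(j , a , b)`, since the row of `f j` takes each
  -- value at most once.
  allBlocked⇒≤ : ∀ {i} (f : Fin i → Fin n) → (∀ w → Blocked f w) → n ≤ i * (i * i)
  allBlocked⇒≤ {i} f blocked = Fin.injective⇒≤ {f = code} code-injective
    where
    code : Fin n → Fin (i * (i * i))
    code w with (j , a , b , _) ← blocked w = combine j (combine a b)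
    code-injective : Injective _≡_ _≡_ code
    code-injective {w} {w′} e
      with (j , a , b , p) ← blocked w | (j′ , a′ , b′ , p′) ← blocked w′
      with refl , e′ ← Fin.combine-injective j (combine a b) j′ (combine a′ b′) e
      with refl , refl ← Fin.combine-injective a b a′ b′ e′
      = d-latin (f j) (trans p (sym p′))

  extend : ∀ {i} → Fin n → (Fin i → Fin n) → Fin (suc i) → Fin n
  extend w f zero    = w
  extend w f (suc j) = f j

  -- A new edge cannot repeat an old value because `w` is free, and two new edges differ because the
  -- row of `w` is injective.
  extend-rainbow : ∀ {i} {w} {f : Fin i → Fin n} → ¬ Blocked f w → Rainbow f → Rainbow (extend w f)
  extend-rainbow {w = w} {f} free rainbow = go
    where
    new : ∀ b {x y} → d w (f b) ≡ d (extend w f x) (extend w f y) → SameEdge (zero , suc b) (x , y)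
    -- The edge from `w` to `f b` would have the diagonal value, which the triple `(b , b , b)`
    -- blocks.
    new b {zero}  {zero}  e = contradiction (b , b , b , (begin
      d (f b) w     ≡⟨ d-sym (f b) w ⟩
      d w (f b)     ≡⟨ e ⟩
      d w w         ≡⟨ d-diag w ⟩
      0             ≡⟨ d-diag (f b) ⟨
      d (f b) (f b) ∎)) free
      where open ≡-Reasoning
    new b {zero}  {suc y} e = inj₁ (refl , cong suc (Rainbow⇒injective rainbow (d-latin w e)))
    new b {suc x} {zero}  e with new b {zero} {suc x} (trans e (d-sym (f x) w))
    ... | inj₁ (_ , b≡x) = inj₂ (refl , b≡x)
    new b {suc x} {suc y} e = contradiction (b , x , y , trans (d-sym (f b) w) e) free

    go : Rainbow (extend w f)
    go {zero}  {zero}  a≢b _ = contradiction refl a≢b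
    go {zero}  {suc b} _   e = new b e
    go {suc a} {zero}  _   e with new a (trans (d-sym w (f a)) e)
    ... | inj₁ (p , q) = inj₂ (q , p)
    ... | inj₂ (p , q) = inj₁ (q , p)
    go {suc a} {suc b} {suc x} {suc y} a≢b e with rainbow (a≢b ∘ cong suc) e
    ... | inj₁ (p , q) = inj₁ (cong suc p , cong suc q)
    ... | inj₂ (p , q) = inj₂ (cong suc p , cong suc q)
    go {suc a} {suc b} {suc x} {zero}  _   e = contradiction (x , a , b , sym e) free
    go {suc a} {suc b} {zero}  {suc y} _   e =
      contradiction (y , a , b , trans (d-sym (f y) w) (sym e)) free
    -- All diagonal values agree, so the pair `(a , a)` replaces the one at `w` and the old rainbow
    -- property applies.
    go {suc a} {suc b} {zero}  {zero}  a≢b e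
      with rainbow {x = a} {a} (a≢b ∘ cong suc) (trans e (trans (d-diag w) (sym (d-diag (f a)))))
    ... | inj₁ (_ , refl) = contradiction refl a≢b
    ... | inj₂ (_ , refl) = contradiction refl a≢b

  rainbowClique : ∀ i → i ^ 3 ≤ n → Σ[ f ∈ (Fin i → Fin n) ] Rainbow f
  rainbowClique zero    _ = (λ ()) , λ {}
  rainbowClique (suc i) [1+i]³≤n
    with f , rainbow ← rainbowClique i (≤-trans (^-monoˡ-≤ 3 (n≤1+n i)) [1+i]³≤n)
    with w , free ← Fin.¬∀⟶∃¬ n (Blocked f) (blocked? f)
                      (<⇒≱ (<-≤-trans (i*[i*i]<[1+i]³ i) [1+i]³≤n) ∘ allBlocked⇒≤ f)
    = extend w f , extend-rainbow free rainbow

module _ {n} (c : EdgeColoring (K n)) (proper : Proper c) where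
  open EdgeColoring c

  -- No edge has the colour 0, so putting it on the diagonal keeps rows injective.
  diagColor : Fin n → Fin n → ℕ
  diagColor u v with u Fin.≟ v
  ... | yes _ = 0
  ... | no  _ = color u v

  diagColor-diag : ∀ u → diagColor u u ≡ 0
  diagColor-diag u with u Fin.≟ u
  ... | yes _   = refl
  ... | no  u≢u = contradiction refl u≢u

  diagColor-off : ∀ {u v} → u ≢ v → diagColor u v ≡ color u v
  diagColor-off {u} {v} u≢v with u Fin.≟ v
  ... | yes u≡v = contradiction u≡v u≢v
  ... | no  _   = refl

  diagColor-sym : ∀ u v → diagColor u v ≡ diagColor v u
  diagColor-sym u v with u Fin.≟ v | v Fin.≟ u
  ... | yes _   | yes _   = refl
  ... | yes u≡v | no  v≢u = contradiction (sym u≡v) v≢u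
  ... | no  u≢v | yes v≡u = contradiction (sym v≡u) u≢v
  ... | no  u≢v | no  _   = color-sym u≢v

  diagColor-latin : ∀ u {v w} → diagColor u v ≡ diagColor u w → v ≡ w
  diagColor-latin u {v} {w} e with u Fin.≟ v | u Fin.≟ w
  ... | yes u≡v | yes u≡w = trans (sym u≡v) u≡w
  ... | yes _   | no  u≢w = contradiction e (<⇒≢ (color≥1 u≢w))
  ... | no  u≢v | yes _   = contradiction (sym e) (<⇒≢ (color≥1 u≢v))
  ... | no  u≢v | no  u≢w with v Fin.≟ w
  ...   | yes v≡w = v≡w
  ...   | no  v≢w = contradiction e (proper u≢v u≢w v≢w)

-- The rainbow clique has one vertex for each vertex of `H`, so `H` sits in it with its own labels
-- and inherits the distinct colors.
LocalBound-order³ : ∀ H → LocalBound H (Graph.order H ^ 3)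
LocalBound-order³ H c proper
  with f , rainbow ← rainbowClique (diagColor c proper) (diagColor-sym c proper)
                       (diagColor-diag c proper) (diagColor-latin c proper) (Graph.order H) ≤-refl
  = record
  { embed     = f
  ; injective = f-injective
  ; edge      = λ u~v → _ , (λ fu≡fv → ~-irrefl (f-injective fu≡fv) u~v) , refl
  ; rainbow   = λ u~v x~y (fu≢fv , p) (fx≢fy , q) → rainbow (λ u≡v → ~-irrefl u≡v u~v)
      (trans (off fu≢fv) (trans p (trans (sym q) (sym (off fx≢fy)))))
  }
  where
  open Graph H
  off : ∀ {u v} → u ≢ v → diagColor c proper u v ≡ EdgeColoring.color c u v
  off = diagColor-off c proper
  f-injective : Injective _≡_ _≡_ f
  f-injective = Rainbow⇒injective (diagColor c proper) (diagColor-sym c proper)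
                       (diagColor-diag c proper) (diagColor-latin c proper) rainbow

-- The game

flip : ℕ × ℕ × ℕ → ℕ × ℕ × ℕ
flip (u , v , k) = v , u , k

-- Both orientations in one list turn `built` into membership, which can be searched and counted.
darts : Position → Position
darts p = p ++ map flip p

built⇒∈darts : ∀ {p u v k} → built p u v k → (u , v , k) ∈ darts p
built⇒∈darts     (inj₁ uv∈) = ∈-++⁺ˡ uv∈
built⇒∈darts {p} (inj₂ vu∈) = ∈-++⁺ʳ p (∈-map⁺ flip vu∈)

∈darts⇒built : ∀ {p u v k} → (u , v , k) ∈ darts p → built p u v k
∈darts⇒built {p} uv∈ with ∈-++⁻ p uv∈
... | inj₁ uv∈p = inj₁ uv∈p
... | inj₂ uv∈f with _ , vu∈ , refl ← ∈-map⁻ flip uv∈f = inj₂ vu∈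

built-sym : ∀ {p u v k} → built p u v k → built p v u k
built-sym (inj₁ uv∈) = inj₂ uv∈
built-sym (inj₂ vu∈) = inj₁ vu∈

built? : ∀ p u v → Dec (∃ λ k → built p u v k)
built? p u v = map′ toBuilt (λ (k , b) → lose (built⇒∈darts b) (refl , refl))
                    (any? (λ (x , y , _) → (x ≟ u) ×-dec (y ≟ v)) (darts p))
  where
  toBuilt : Any (λ (x , y , _) → x ≡ u × y ≡ v) (darts p) → ∃ λ k → built p u v k
  toBuilt any with (_ , _ , k) , d∈ , refl , refl ← find any = k , ∈darts⇒built d∈

usedAt? : ∀ p u k → Dec (∃ λ w → built p u w k)
usedAt? p u k = map′ toBuilt (λ (w , b) → lose (built⇒∈darts b) (refl , refl))
                     (any? (λ (x , _ , l) → (x ≟ u) ×-dec (l ≟ k)) (darts p))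
  where
  toBuilt : Any (λ (x , _ , l) → x ≡ u × l ≡ k) (darts p) → ∃ λ w → built p u w k
  toBuilt any with (_ , w , _) , d∈ , refl , refl ← find any = w , ∈darts⇒built d∈

properRule? : ∀ p u v → Decidable (ProperRule p u v)
properRule? p u v k = map′
  (λ (k≥1 , u∌k , v∌k) → k≥1 , λ w → (λ b → u∌k (w , b)) , (λ b → v∌k (w , b)))
  (λ (k≥1 , free) → k≥1 , (λ (w , b) → proj₁ (free w) b) , (λ (w , b) → proj₂ (free w) b))
  ((1 ≤? k) ×-dec (¬? (usedAt? p u k) ×-dec ¬? (usedAt? p v k)))

-- One more than the largest color present is positive and new at every vertex.
properReply : ∀ p u v → ∃ (ProperRule p u v)
properReply p u v = suc top , s≤s z≤n , λ w → unused , unused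
  where
  colors : List ℕ
  colors = map (proj₂ ∘ proj₂) (darts p)
  top : ℕ
  top = max 0 colors
  unused : ∀ {x w} → ¬ built p x w (suc top)
  unused b = <⇒≱ ≤-refl (All.lookup (xs≤max 0 colors) (∈-map⁺ (proj₂ ∘ proj₂) (built⇒∈darts b)))

-- Without an answer by Painter a `build` node would win vacuously, and no lower bound on the number
-- of moves could follow.
firstFitReply : ∀ p u v → ∃ (FirstFitRule p u v)
firstFitReply p u v = let k , proper = properReply p u v in ∃⇒IsLeast (properRule? p u v) k proper

-- First-Fit answers are among the proper ones, so the same tree works after pruning its other
-- branches.
Online⇒FirstFit : ∀ {H t p} → BuilderWins ProperRule H t p → BuilderWins FirstFitRule H t p
Online⇒FirstFit (done copy)            = done copy
Online⇒FirstFit (build u v able reply) =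
  build u v able (λ k least → Online⇒FirstFit (reply k (proj₁ least)))

module _ {H : Graph} (noIsolated : NoIsolatedVertices H) where
  open Graph H

  -- Each vertex of `H` has a neighbour, so its image is the start of a dart; a position has two
  -- darts per edge.
  RainbowCopy⇒order≤ : ∀ {p} → RainbowCopy H (built p) → order ≤ 2 * length p
  RainbowCopy⇒order≤ {p} copy = subst (order ≤_) length≡ (injective-∈⇒≤ injective embed∈)
    where
    open RainbowCopy copy
    embed∈ : ∀ u → embed u ∈ map proj₁ (darts p)
    embed∈ u with v , u~v ← noIsolated u with k , b ← edge u~v = ∈-map⁺ proj₁ (built⇒∈darts b)
    length≡ : length (map proj₁ (darts p)) ≡ 2 * length p
    length≡ = begin
      length (map proj₁ (darts p))    ≡⟨ length-map proj₁ (darts p) ⟩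
      length (darts p)                ≡⟨ length-++ p ⟩
      length p + length (map flip p)  ≡⟨ cong (length p +_) (length-map flip p) ⟩
      length p + length p             ≡⟨ cong (length p +_) (+-identityʳ (length p)) ⟨
      2 * length p                    ∎
      where open ≡-Reasoning

  -- Follows the play against First-Fit down to a leaf. Each move takes one from `t` and adds one to
  -- `length p`, so their sum is constant.
  FirstFit⇒order≤ : ∀ {t p} → BuilderWins FirstFitRule H t p → order ≤ 2 * (t + length p)
  FirstFit⇒order≤ {t} {p} (done copy) =
    ≤-trans (RainbowCopy⇒order≤ copy) (*-monoʳ-≤ 2 (m≤n+m (length p) t))
  FirstFit⇒order≤ {suc t} {p} (build u v _ reply) with k , least ← firstFitReply p u v =
    subst (λ m → order ≤ 2 * m) (+-suc t (length p)) (FirstFit⇒order≤ (reply k least))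

-- Proper positions, and Builder's strategy from a forcing graph

record ProperPosition (p : Position) : Set where
  field
    built≥1      : ∀ {u v k} → built p u v k → 1 ≤ k
    built-proper : ∀ {u v w k} → built p u v k → built p u w k → v ≡ w
    built-unique : ∀ {u v k l} → built p u v k → built p u v l → k ≡ l

[]-proper : ProperPosition []
[]-proper = record
  { built≥1      = λ { (inj₁ ()) ; (inj₂ ()) }
  ; built-proper = λ { (inj₁ ()) ; (inj₂ ()) }
  ; built-unique = λ { (inj₁ ()) ; (inj₂ ()) }
  }

data BuiltStep (p : Position) (u v k : ℕ) : ℕ → ℕ → ℕ → Set where
  new   : BuiltStep p u v k u v k
  new′  : BuiltStep p u v k v u k
  old   : ∀ {x y l} → built p x y l → BuiltStep p u v k x y l

builtStep : ∀ {p u v k x y l} → built ((u , v , k) ∷ p) x y l → BuiltStep p u v k x y l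
builtStep (inj₁ (here refl)) = new
builtStep (inj₁ (there xy∈)) = old (inj₁ xy∈)
builtStep (inj₂ (here refl)) = new′
builtStep (inj₂ (there yx∈)) = old (inj₂ yx∈)

-- `ProperRule` excludes a repeated color at a vertex; `Buildable` excludes loops and a second color
-- on the same pair.
∷-proper : ∀ {p u v k} → ProperPosition p → Buildable p u v → ProperRule p u v k →
           ProperPosition ((u , v , k) ∷ p)
∷-proper {p} {u} {v} {k} proper (u≢v , unbuilt) (k≥1 , free) = record
  { built≥1      = λ b → built≥1′ (builtStep b)
  ; built-proper = λ b b′ → proper′ (builtStep b) (builtStep b′)
  ; built-unique = λ b b′ → unique′ (builtStep b) (builtStep b′)
  }
  where
  open ProperPosition proper
  built≥1′ : ∀ {x y l} → BuiltStep p u v k x y l → 1 ≤ l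
  built≥1′ new     = k≥1
  built≥1′ new′    = k≥1
  built≥1′ (old b) = built≥1 b
  proper′ : ∀ {x y z l} → BuiltStep p u v k x y l → BuiltStep p u v k x z l → y ≡ z
  proper′ new     new      = refl
  proper′ new     new′     = contradiction refl u≢v
  proper′ new     (old b)  = contradiction b (proj₁ (free _))
  proper′ new′    new      = contradiction refl u≢v
  proper′ new′    new′     = refl
  proper′ new′    (old b)  = contradiction b (proj₂ (free _))
  proper′ (old b) new      = contradiction b (proj₁ (free _))
  proper′ (old b) new′     = contradiction b (proj₂ (free _))
  proper′ (old b) (old b′) = built-proper b b′
  unique′ : ∀ {x y l m} → BuiltStep p u v k x y l → BuiltStep p u v k x y m → l ≡ m
  unique′ new     new      = refl
  unique′ new     new′     = refl
  unique′ new     (old b)  = contradiction (_ , b) unbuilt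
  unique′ new′    new      = refl
  unique′ new′    new′     = refl
  unique′ new′    (old b)  = contradiction (_ , built-sym b) unbuilt
  unique′ (old b) new      = contradiction (_ , b) unbuilt
  unique′ (old b) new′     = contradiction (_ , built-sym b) unbuilt
  unique′ (old b) (old b′) = built-unique b b′

module _ {G H : Graph} (forces : ForcesRainbow G H) where
  open Graph G

  BuiltEdge : Position → Vertex → Vertex → Set
  BuiltEdge p u v = ∃ λ k → built p (toℕ u) (toℕ v) k

  -- The position colors `G` properly, so a rainbow copy exists in `G`, and `toℕ` carries it into
  -- the game. By `built-unique` its edges have no other color there.
  allBuilt⇒copy : ∀ {p} → ProperPosition p → (∀ {u v} → (u , v) ∈ edges → BuiltEdge p u v) →
                  RainbowCopy H (built p)
  allBuilt⇒copy {p} proper allBuilt = record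
    { embed     = toℕ ∘ embed
    ; injective = injective ∘ Fin.toℕ-injective
    ; edge      = λ u~v → _ , built-color (edge~ u~v)
    ; rainbow   = λ u~v x~y b b′ →
        rainbow u~v x~y (edge~ u~v , color≡ (edge~ u~v) b) (edge~ x~y , color≡ (edge~ x~y) b′)
    }
    where
    open ProperPosition proper
    allBuilt~ : ∀ {u v} → u ~ v → BuiltEdge p u v
    allBuilt~ u~v with ~⇒∈edges G u~v
    ... | inj₁ uv∈ = allBuilt uv∈
    ... | inj₂ vu∈ = map₂ built-sym (allBuilt vu∈)
    color : Vertex → Vertex → ℕ
    color u v with built? p (toℕ u) (toℕ v)
    ... | yes (k , _) = k
    -- A default that adjacent pairs of `G` never take, since all of them are built.
    ... | no  _       = 0
    built-color : ∀ {u v} → u ~ v → built p (toℕ u) (toℕ v) (color u v)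
    built-color {u} {v} u~v with built? p (toℕ u) (toℕ v)
    ... | yes (_ , b) = b
    ... | no  unbuilt = contradiction (allBuilt~ u~v) unbuilt
    color≡ : ∀ {u v k} → u ~ v → built p (toℕ u) (toℕ v) k → color u v ≡ k
    color≡ u~v = built-unique (built-color u~v)
    coloring : EdgeColoring G
    coloring = record
      { color     = color
      ; color-sym = λ u~v → color≡ u~v (built-sym (built-color (~-sym u~v)))
      ; color≥1   = built≥1 ∘ built-color
      }
    coloring-proper : Proper coloring
    coloring-proper {u} u~v u~w v≢w e = v≢w (Fin.toℕ-injective
      (built-proper (built-color u~v) (subst (built p (toℕ u) _) (sym e) (built-color u~w))))
    open RainbowCopy (forces coloring coloring-proper)
    edge~ : ∀ {u v} → Graph._~_ H u v → embed u ~ embed v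
    edge~ u~v = proj₁ (proj₂ (edge u~v))

  -- Builder works through the edge list of `G`. The invariant is that every edge of `G` is still in
  -- `rest` or already built.
  buildAll : ∀ t rest {p} → length rest ≤ t → ProperPosition p → rest ⊆ edges →
             (∀ {u v} → (u , v) ∈ edges → (u , v) ∈ rest ⊎ BuiltEdge p u v) →
             BuilderWins ProperRule H t p
  buildAll t []             _           proper _     cover =
    done (allBuilt⇒copy proper (λ e∈ → [ (λ ()) , id ]′ (cover e∈)))
  buildAll (suc t) ((u , v) ∷ rest) {p} (s≤s len≤t) proper rest⊆ cover
    with built? p (toℕ u) (toℕ v)
  -- An edge found already built is skipped, leaving a spare move in the budget; in the other case
  -- the test itself supplies part of `Buildable`.
  ... | yes b = buildAll (suc t) rest (m≤n⇒m≤1+n len≤t) proper (rest⊆ ∘ there) cover′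
    where
    cover′ : ∀ {x y} → (x , y) ∈ edges → (x , y) ∈ rest ⊎ BuiltEdge p x y
    cover′ e∈ with cover e∈
    ... | inj₁ (here refl) = inj₂ b
    ... | inj₁ (there r∈)  = inj₁ r∈
    ... | inj₂ b′          = inj₂ b′
  ... | no unbuilt = build (toℕ u) (toℕ v) able λ k rule →
      buildAll t rest len≤t (∷-proper proper able rule) (rest⊆ ∘ there) (cover′ k)
    where
    able : Buildable p (toℕ u) (toℕ v)
    -- Listed edges have their smaller endpoint first, hence distinct endpoints; this is why
    -- `rest ⊆ edges` is carried along.
    able = <⇒≢ (proj₁ (∈edges⇒<×~ G (rest⊆ (here refl)))) , unbuilt
    later : ∀ {e x y k} → built p x y k → built (e ∷ p) x y k
    later (inj₁ xy∈) = inj₁ (there xy∈)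
    later (inj₂ yx∈) = inj₂ (there yx∈)
    cover′ : ∀ k {x y} → (x , y) ∈ edges →
             (x , y) ∈ rest ⊎ BuiltEdge ((toℕ u , toℕ v , k) ∷ p) x y
    cover′ k e∈ with cover e∈
    ... | inj₁ (here refl) = inj₂ (k , inj₁ (here refl))
    ... | inj₁ (there r∈)  = inj₁ r∈
    ... | inj₂ (l , b)     = inj₂ (l , later b)

  ForcesRainbow⇒Online : OnlineBound H size
  ForcesRainbow⇒Online = buildAll size edges ≤-refl []-proper id inj₁

-- Minimum degree

module _ {G H : Graph} {c : EdgeColoring G} (copy : RainbowCopy H (colored c)) where
  private
    module G = Graph G
    module H = Graph H
  open RainbowCopy copy

  -- The embedding sends the neighbours of `u` injectively to neighbours of `embed u`.
  embed-degree≥δ : ∀ u → δ H ≤ G.degree (embed u)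
  embed-degree≥δ u = begin
    δ H                                ≤⟨ δ≤degree H u ⟩
    length neighbours                  ≡⟨ length-map embed neighbours ⟨
    length (map embed neighbours)      ≤⟨ Unique-⊆⇒length≤ unique ⊆neighbours ⟩
    G.degree (embed u)                 ∎
    where
    open ≤-Reasoning
    neighbours : List H.Vertex
    neighbours = filter (u H.~?_) (allFin H.order)
    unique : Unique (map embed neighbours)
    unique = Unique.map⁺ injective (Unique.filter⁺ (u H.~?_) (Unique.allFin⁺ H.order))
    ⊆neighbours : map embed neighbours ⊆ filter (embed u G.~?_) (allFin G.order)
    ⊆neighbours w∈ with v , v∈ , refl ← ∈-map⁻ embed w∈ =
      ∈-filter⁺ (embed u G.~?_) (∈-allFin (embed v))
        (proj₁ (proj₂ (edge (proj₂ (∈-filter⁻ (u H.~?_) {xs = allFin H.order} v∈)))))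

module _ {G H : Graph} (forces : ForcesRainbow G H) where
  private
    module G = Graph G
    module H = Graph H

  core : List G.Vertex
  core = highDegree G (δ H)

  High : G.Vertex → Set
  High v = δ H ≤ G.degree v

  high? : Decidable High
  high? v = δ H ≤? G.degree v

  rank : ∀ {v} → High v → Fin (length core)
  rank {v} h = Any.index (∈-filter⁺ high? (∈-allFin v) h)

  rank-injective : ∀ {u v} (h : High u) (h′ : High v) → rank h ≡ rank h′ → u ≡ v
  rank-injective h h′ =
    index-injective (setoid G.Vertex) (∈-filter⁺ high? (∈-allFin _) h) (∈-filter⁺ high? (∈-allFin _) h′)

  -- A copy of H only uses vertices of degree at least δ H, so a colouring of the
  -- complete graph on those vertices may be extended to G by any proper colouring
  -- with new colours: here u + v, kept apart from the old colours by parity.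
  LocalBound-core : LocalBound H (length core)
  LocalBound-core c proper = record
    { embed     = λ u → rank (high u)
    ; injective = λ {u} {v} e → injective (rank-injective (high u) (high v) e)
    ; edge      = λ u~v → _ , rank≢ u~v , refl
    -- Two edges of color `k` in the complete graph both have color `2 * k` in `G`, where the copy
    -- is rainbow.
    ; rainbow   = λ u~v x~y (_ , p) (_ , q) →
        rainbow u~v x~y (edge~ u~v , trans (color-high (high _) (high _)) (cong (2 *_) p))
                        (edge~ x~y , trans (color-high (high _) (high _)) (cong (2 *_) q))
    }
    where
    module c = EdgeColoring c
    -- Taking the two decisions as arguments lets each property below be proved by matching on them.
    mix : ∀ {u v} → Dec (High u) → Dec (High v) → ℕ
    mix         (yes h) (yes h′) = 2 * c.color (rank h) (rank h′)
    mix {u} {v} _       _        = suc (2 * (toℕ u + toℕ v))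
    color : G.Vertex → G.Vertex → ℕ
    color u v = mix (high? u) (high? v)
    -- `rank` depends on a proof of `High`; irrelevance of `≤` replaces the one found by `high?`
    -- with the given one.
    color-high : ∀ {u v} (h : High u) (h′ : High v) → color u v ≡ 2 * c.color (rank h) (rank h′)
    color-high {u} {v} h h′ = cong₂ mix (dec-yes-irr (high? u) ≤-irrelevant h)
                                        (dec-yes-irr (high? v) ≤-irrelevant h′)
    rank-distinct : ∀ {u v} (h : High u) (h′ : High v) → u ≢ v → rank h ≢ rank h′
    rank-distinct h h′ u≢v = u≢v ∘ rank-injective h h′
    ~⇒≢ : ∀ {u v} → u G.~ v → u ≢ v
    ~⇒≢ u~v u≡v = G.~-irrefl u≡v u~v
    mix-sym : ∀ {u v} (du : Dec (High u)) (dv : Dec (High v)) → u G.~ v → mix du dv ≡ mix dv du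
    mix-sym (yes h) (yes h′) u~v = cong (2 *_) (c.color-sym (rank-distinct h h′ (~⇒≢ u~v)))
    mix-sym {u} {v} (yes _) (no _)  _ = cong (λ m → suc (2 * m)) (+-comm (toℕ u) (toℕ v))
    mix-sym {u} {v} (no _)  (yes _) _ = cong (λ m → suc (2 * m)) (+-comm (toℕ u) (toℕ v))
    mix-sym {u} {v} (no _)  (no _)  _ = cong (λ m → suc (2 * m)) (+-comm (toℕ u) (toℕ v))
    mix≥1 : ∀ {u v} (du : Dec (High u)) (dv : Dec (High v)) → u G.~ v → 1 ≤ mix du dv
    mix≥1 (yes h) (yes h′) u~v = ≤-trans (c.color≥1 (rank-distinct h h′ (~⇒≢ u~v))) (m≤n*m _ 2)
    mix≥1 (yes _) (no _)   _   = s≤s z≤n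
    mix≥1 (no _)  _        _   = s≤s z≤n
    new-distinct : ∀ {u v w : G.Vertex} → v ≢ w →
                   suc (2 * (toℕ u + toℕ v)) ≢ suc (2 * (toℕ u + toℕ w))
    new-distinct {u} v≢w e = v≢w (Fin.toℕ-injective
      (+-cancelˡ-≡ (toℕ u) _ _ (*-cancelˡ-≡ _ _ 2 (suc-injective e))))
    mix-proper : ∀ {u v w} (du : Dec (High u)) (dv : Dec (High v)) (dw : Dec (High w)) →
                 u G.~ v → u G.~ w → v ≢ w → mix du dv ≢ mix du dw
    mix-proper (yes h) (yes h′) (yes h″) u~v u~w v≢w e =
      proper (rank-distinct h h′ (~⇒≢ u~v)) (rank-distinct h h″ (~⇒≢ u~w)) (rank-distinct h′ h″ v≢w)
             (*-cancelˡ-≡ _ _ 2 e)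
    mix-proper {u} {w = w} (yes h) (yes h′) (no _) _ _ _ =
      even≢odd (c.color (rank h) (rank h′)) (toℕ u + toℕ w)
    mix-proper {u} {v} (yes h) (no _) (yes h″) _ _ _ =
      even≢odd (c.color (rank h) (rank h″)) (toℕ u + toℕ v) ∘ sym
    mix-proper {u} (yes _) (no _) (no _) _ _ v≢w = new-distinct {u} v≢w
    mix-proper {u} (no _)  _      _      _ _ v≢w = new-distinct {u} v≢w
    coloring : EdgeColoring G
    coloring = record
      { color     = color
      ; color-sym = λ {u} {v} → mix-sym (high? u) (high? v)
      ; color≥1   = λ {u} {v} → mix≥1 (high? u) (high? v)
      }
    copy : RainbowCopy H (colored coloring)
    copy = forces coloring (λ {u} {v} {w} → mix-proper (high? u) (high? v) (high? w))
    open RainbowCopy copy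
    high : ∀ u → High (embed u)
    high = embed-degree≥δ {c = coloring} copy
    edge~ : ∀ {u v} → u H.~ v → embed u G.~ embed v
    edge~ u~v = proj₁ (proj₂ (edge u~v))
    rank≢ : ∀ {u v} → u H.~ v → rank (high u) ≢ rank (high v)
    rank≢ {u} {v} u~v = rank-distinct (high u) (high v) (~⇒≢ (edge~ u~v))

-- The first clause shows that the four sets have elements, so the numbers compared afterwards are
-- minima of nonempty sets. The cube root and the fractions are cleared from the inequalities.
theorem1 : (H : Graph) → NoIsolatedVertices H →
    (Satisfiable (LocalBound H) × Satisfiable (FirstFitBound H) × Satisfiable (OnlineBound H) × Satisfiable (SizeBound H)) ×
    ((loc ff onl siz : ℕ) →
    IsAR-loc H loc → IsAR-FF H ff → IsAR-online H onl → IsAR-size H siz →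
    (loc ≤ (2 * ff) ^ 3 × ff ≤ onl × onl ≤ siz × siz ≤ loc C 2) ×
    (loc * δ H ≤ 2 * siz))
theorem1 H noIsolated =
  ( (_ , local) , (_ , Online⇒FirstFit (ForcesRainbow⇒Online local))
  , (_ , ForcesRainbow⇒Online local) , (_ , K _ , refl , local)) ,
  λ { loc ff onl siz (locB , loc≤) (ffB , ff≤) (onlB , onl≤) ((G , refl , forces) , siz≤) →
    -- With h the order of `H`, `loc` is at most the cube of h, and h is at most `2 * ff` because
    -- play starts from the empty position.
    ( ≤-trans (loc≤ _ local) (^-monoˡ-≤ 3
        (subst (λ m → Graph.order H ≤ 2 * m) (+-identityʳ ff) (FirstFit⇒order≤ noIsolated ffB)))
    , ff≤ onl (Online⇒FirstFit onlB)
    , onl≤ siz (ForcesRainbow⇒Online forces)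
    , ≤-trans (siz≤ _ (K loc , refl , locB)) (size-K≤ loc)) ,
    ≤-trans (*-monoˡ-≤ (δ H) (loc≤ _ (LocalBound-core forces))) (highDegree*≤2*size G (δ H)) }
  where
  local : LocalBound H (Graph.order H ^ 3)
  local = LocalBound-order³ H
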